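{- Let $G$ be a finite tree with $n$ vertices and let $k$ be a positive integer. For every initial configuration $x(0)$ of the $k$-reversible process on $G$, the transient length satisfies $\tau(x(0))\leq n(k+1)-1$.
   Context: Let $V(G)=\{v_1,\dots,v_n\}$. A configuration is an assignment of a state in $\{ -1,+1\}$ to each vertex. In the $k$-reversible process on $G$ with initial configuration $x(0)$, $x_i(t)$ denotes the state of $v_i$ at discrete time $t=0,1,2,\dots$, and $x(t)=(x_1(t),\dots,x_n(t))$. Let $\mathit{op}_i(t)$ be the number of neighbors of $v_i$ whose state at time $t$ is different from $x_i(t)$. All vertices are updated simultaneously: $x_i(t+1)=-x_i(t)$ if $\mathit{op}_i(t)\geq k$, and $x_i(t+1)=x_i(t)$ otherwise. The period length $p(x(0))\ge 1$ and the transient length $\tau(x(0))\geq 0$ are the integers such that: $x(t+p(x(0)))=x(t)$ for all $t\geq\tau(x(0))$; and, for integers $t\ge 0$ and $q\geq 1$, $x(t+q)\neq x(t)$ whenever $t<\tau(x(0))$ or $q<p(x(0))$. -}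

module Defs where

open import Data.Bool.Base using (if_then_else_)
open import Data.Fin.Base using (Fin; zero; suc; inject₁; fromℕ; toℕ; combine)
open import Data.Fin.Properties using (pigeonhole; combine-injective)
open import Data.Nat.Base
open import Data.Nat.GeneralisedArithmetic using (fold)
open import Data.Nat.Properties
  using (_≤?_; n<1+n; +-assoc; +-comm; m≤m+n; m≤n+m; m≤m*n; ≮⇒≥;
         m+[n∸m]≡n; m∸n+n≡m; m<n⇒0<n∸m; <⇒≤; ≤-refl; ≤-trans; ≤-antisym)
open import Data.Product.Base using (∃; ∃₂; _×_; _,_; proj₁; proj₂)
open import Data.Sign as Sign using (Sign; opposite)
open import Data.Sum.Base using (_⊎_; inj₁; inj₂)
open import Data.Vec.Base using (Vec; []; _∷_; lookup; tabulate; allFin; count)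
open import Data.Vec.Properties using (≡-dec)
open import Function.Definitions using (Injective)
open import Relation.Binary.Construct.Closure.ReflexiveTransitive using (Star)
open import Relation.Binary.Definitions using (Symmetric; Irreflexive; Decidable; DecidableEquality)
open import Relation.Binary.PropositionalEquality
open import Relation.Nullary.Decidable using (yes; no; does; ¬?; _×-dec_)
open import Relation.Nullary.Negation using (¬_; contradiction)
import Relation.Unary as Unary

record Graph (n : ℕ) : Set₁ where
  field
    _~_      : Fin n → Fin n → Set
    ~-sym    : Symmetric _~_
    ~-irrefl : Irreflexive _≡_ _~_
    _~?_     : Decidable _~_

module _ {n : ℕ} (G : Graph n) where
  open Graph G

  Connected : Set
  Connected = ∀ u v → Star _~_ u v

  -- A cycle on the 1 + m ≥ 3 distinct vertices c 0, …, c m.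
  record Cycle : Set where
    field
      m           : ℕ
      m≥2         : 2 ≤ m
      c           : Fin (suc m) → Fin n
      c-injective : Injective _≡_ _≡_ c
      c-step      : ∀ (i : Fin m) → c (inject₁ i) ~ c (suc i)
      c-close     : c (fromℕ m) ~ c zero

  record IsTree : Set where
    field
      nonempty  : 1 ≤ n
      connected : Connected
      acyclic   : ¬ Cycle

Config : ℕ → Set
Config n = Vec Sign n

module _ {n : ℕ} (G : Graph n) where
  open Graph G

  op : Config n → Fin n → ℕ
  op x i = count (λ j → (i ~? j) ×-dec ¬? (lookup x j Sign.≟ lookup x i)) (allFin n)

  step : ℕ → Config n → Config n
  step k x = tabulate λ i →
    if does (k ≤? op x i) then opposite (lookup x i) else lookup x i

  process : ℕ → Config n → ℕ → Config n
  process k x₀ t = fold x₀ (step k) t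

record IsPeriodTransient {A : Set} (x : ℕ → A) (p τ : ℕ) : Set where
  field
    p≥1      : 1 ≤ p
    periodic : ∀ t → τ ≤ t → x (t + p) ≡ x t
    minimal  : ∀ t q → 1 ≤ q → t < τ ⊎ q < p → x (t + q) ≢ x t

-- The two lengths are uniquely determined by IsPeriodTransient, so the way
-- repeat⇒periodTransient computes them does not matter.

module _ {A : Set} {x : ℕ → A} where
  open IsPeriodTransient

  private
    p≤p′ : ∀ {p τ p′ τ′} → IsPeriodTransient x p τ → IsPeriodTransient x p′ τ′ → p ≤ p′
    p≤p′ {τ′ = τ′} P P′ = ≮⇒≥ λ p′<p →
      minimal P τ′ _ (p≥1 P′) (inj₂ p′<p) (periodic P′ τ′ ≤-refl)

    τ≤τ′ : ∀ {p τ p′ τ′} → IsPeriodTransient x p τ → IsPeriodTransient x p′ τ′ → τ ≤ τ′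
    τ≤τ′ {τ′ = τ′} P P′ = ≮⇒≥ λ τ′<τ →
      minimal P τ′ _ (p≥1 P′) (inj₁ τ′<τ) (periodic P′ τ′ ≤-refl)

  period-unique : ∀ {p τ p′ τ′} → IsPeriodTransient x p τ → IsPeriodTransient x p′ τ′ → p ≡ p′
  period-unique P P′ = ≤-antisym (p≤p′ P P′) (p≤p′ P′ P)

  transient-unique : ∀ {p τ p′ τ′} → IsPeriodTransient x p τ → IsPeriodTransient x p′ τ′ → τ ≡ τ′
  transient-unique P P′ = ≤-antisym (τ≤τ′ P P′) (τ≤τ′ P′ P)

private
  least : ∀ {P : ℕ → Set} → Unary.Decidable P → ∀ n → P n →
          ∃ λ m → P m × (∀ i → i < m → ¬ P i)
  least P? n Pn with P? 0
  ... | yes P0 = 0 , P0 , λ _ ()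
  least P? zero    P0 | no ¬P0 = contradiction P0 ¬P0
  least P? (suc n) Pn | no ¬P0 with least (λ i → P? (suc i)) n Pn
  ... | m , Pm , below = suc m , Pm , λ where
    zero    _         → ¬P0
    (suc i) (s≤s i<m) → below i i<m

module _ {A : Set} (_≟_ : DecidableEquality A) (f : A → A) (a : A) where
  private
    x : ℕ → A
    x = fold a f

    shift : ∀ s {i j} → x i ≡ x j → x (s + i) ≡ x (s + j)
    shift zero    e = e
    shift (suc s) e = cong f (shift s e)

    forward : ∀ {i q t} → x (i + q) ≡ x i → i ≤ t → x (t + q) ≡ x t
    forward {i} {q} {t} e i≤t = begin
      x (t + q)             ≡⟨ cong (λ t → x (t + q)) (sym (m∸n+n≡m i≤t)) ⟩
      x ((t ∸ i) + i + q)   ≡⟨ cong x (+-assoc (t ∸ i) i q) ⟩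
      x ((t ∸ i) + (i + q)) ≡⟨ shift (t ∸ i) e ⟩
      x ((t ∸ i) + i)       ≡⟨ cong x (m∸n+n≡m i≤t) ⟩
      x t                   ∎
      where open ≡-Reasoning

    multiple : ∀ {t q} → x (t + q) ≡ x t → ∀ m → x (m * q + t) ≡ x t
    multiple {t} {q} e zero    = refl
    multiple {t} {q} e (suc m) = begin
      x (q + m * q + t)   ≡⟨ cong x (trans (+-assoc q (m * q) t) (+-comm q (m * q + t))) ⟩
      x (m * q + t + q)   ≡⟨ forward e (m≤n+m t (m * q)) ⟩
      x (m * q + t)       ≡⟨ multiple e m ⟩
      x t                 ∎
      where open ≡-Reasoning

    pull : ∀ i r t q → 1 ≤ q → x (i + r) ≡ x i → x (t + q) ≡ x t → x (t + r) ≡ x t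
    pull i r t q@(suc _) _ er eq = begin
      x (t + r)             ≡⟨ cong x (+-comm t r) ⟩
      x (r + t)             ≡⟨ shift r (sym (multiple eq i)) ⟩
      x (r + (i * q + t))   ≡⟨ cong x (+-comm r (i * q + t)) ⟩
      x (i * q + t + r)     ≡⟨ forward er (≤-trans (m≤m*n i q) (m≤m+n (i * q) t)) ⟩
      x (i * q + t)         ≡⟨ multiple eq i ⟩
      x t                   ∎
      where open ≡-Reasoning

  repeat⇒periodTransient : (∃₂ λ i j → i < j × x i ≡ x j) → ∃₂ (IsPeriodTransient x)
  repeat⇒periodTransient (i , j , i<j , xi≡xj)
    with least (λ d → (1 ≤? d) ×-dec (x (i + d) ≟ x i)) (j ∸ i)
           (m<n⇒0<n∸m i<j , trans (cong x (m+[n∸m]≡n (<⇒≤ i<j))) (sym xi≡xj))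
  ... | p , (1≤p , ep) , p-least
    with least (λ t → x (t + p) ≟ x t) i ep
  ... | τ , eτ , τ-least = p , τ , record
    { p≥1      = 1≤p
    ; periodic = λ t → forward eτ
    ; minimal  = λ where
        t q 1≤q (inj₁ t<τ) e → τ-least t t<τ (pull i p t q 1≤q ep e)
        t q 1≤q (inj₂ q<p) e → p-least q q<p (1≤q , pull t q i p 1≤p e ep)
    }

private
  encode : ∀ {n} → Config n → Fin (2 ^ n)
  encode []      = zero
  encode (Sign.- ∷ x) = combine {2} zero (encode x)
  encode (Sign.+ ∷ x) = combine {2} (suc zero) (encode x)

  encode-injective : ∀ {n} (x y : Config n) → encode x ≡ encode y → x ≡ y
  encode-injective []      []      _ = refl
  encode-injective (Sign.- ∷ x) (Sign.- ∷ y) e =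
    cong (Sign.- ∷_) (encode-injective x y (proj₂ (combine-injective {2} zero (encode x) zero (encode y) e)))
  encode-injective (Sign.+ ∷ x) (Sign.+ ∷ y) e =
    cong (Sign.+ ∷_) (encode-injective x y (proj₂ (combine-injective {2} (suc zero) (encode x) (suc zero) (encode y) e)))
  encode-injective (Sign.- ∷ x) (Sign.+ ∷ y) e
    with () ← proj₁ (combine-injective {2} zero (encode x) (suc zero) (encode y) e)
  encode-injective (Sign.+ ∷ x) (Sign.- ∷ y) e
    with () ← proj₁ (combine-injective {2} (suc zero) (encode x) zero (encode y) e)

module _ {n : ℕ} (G : Graph n) (k : ℕ) (x₀ : Config n) where

  periodTransient : ∃₂ (IsPeriodTransient (process G k x₀))
  periodTransient = repeat⇒periodTransient (≡-dec Sign._≟_) (step G k) x₀ repeat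
    where
    repeat : ∃₂ λ i j → i < j × process G k x₀ i ≡ process G k x₀ j
    repeat with pigeonhole (n<1+n (2 ^ n)) (λ t → encode (process G k x₀ (toℕ t)))
    ... | i , j , i<j , e = toℕ i , toℕ j , i<j , encode-injective _ _ e

  periodLength : ℕ
  periodLength = proj₁ periodTransient

  transientLength : ℕ
  transientLength = proj₁ (proj₂ periodTransient)

  isPeriodTransient : IsPeriodTransient (process G k x₀) periodLength transientLength
  isPeriodTransient = proj₂ (proj₂ periodTransient)

{-# OPTIONS --safe #-}
module Submission where

-- For configurations x and y put
--   M x y = Σᵢ (#{j ~ i : y j ≢ x i} + (if x i ≡ y i then deg i else 2k − 1)).
-- M is symmetric, and for fixed y the i-th summand, as a function of the sign
-- x i, has the state of i in the successor of y as its unique minimiser.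
-- Hence M (x (t+2)) (x (t+1)) ≤ M (x t) (x (t+1)) = M (x (t+1)) (x t), strictly
-- unless x (t+2) = x t, which does not happen before the transient is over.
-- So the transient length is at most M (x 1) (x 0) ≤ n (k − 1) + Σᵢ deg i, and
-- in a forest Σᵢ deg i ≤ 2 (n − 1).

open import Defs
open import Data.Bool.Base using (Bool; true; false; not; _∧_; if_then_else_)
open import Data.Fin.Base using (Fin; zero; suc; inject₁; fromℕ; fromℕ<; toℕ; punchIn)
open import Data.Fin.Properties as Fin
  using (any?; pigeonhole; punchIn-injective; punchInᵢ≢i; toℕ-injective;
         toℕ-inject₁; toℕ-fromℕ; toℕ-fromℕ<; toℕ<n)
open import Data.Nat.Base using (ℕ; zero; suc; _≤_; _<_; _+_; _*_; _∸_; z≤n; s≤s; s<s; z<s)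
open import Data.Nat.GeneralisedArithmetic using (fold)
open import Data.Nat.Induction using (Acc; acc; <-wellFounded)
open import Data.Nat.Properties
open import Data.Nat.Tactic.RingSolver using (solve-∀)
open import Data.Product.Base using (∃; ∃₂; _×_; _,_; proj₁; proj₂)
open import Data.Sign as Sign using (Sign; opposite)
open import Data.Sum.Base using (_⊎_; inj₁; inj₂)
open import Data.Vec.Base using (lookup; tabulate; count)
open import Data.Vec.Properties using (lookup∘tabulate; tabulate∘lookup; tabulate-cong)
open import Function.Base using (id; _∘_)
open import Function.Bundles using (mk⇔)
open import Relation.Binary.Definitions using (tri<; tri≈; tri>)
open import Relation.Binary.PropositionalEquality
open import Relation.Nullary.Decidable using (yes; no; does; ¬?; _×-dec_; does-⇔; dec-true; dec-false)
open import Relation.Nullary.Negation using (¬_; contradiction)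
import Relation.Unary as Unary

open import Algebra.Properties.CommutativeMonoid.Sum +-0-commutativeMonoid

-- Finite sums, 0/1 indicators and degrees

sum-mono-≤ : ∀ {n} {f g : Fin n → ℕ} → (∀ i → f i ≤ g i) → sum f ≤ sum g
sum-mono-≤ {zero}  f≤g = z≤n
sum-mono-≤ {suc n} f≤g = +-mono-≤ (f≤g zero) (sum-mono-≤ (f≤g ∘ suc))

sum-mono-< : ∀ {n} {f g : Fin n → ℕ} → (∀ i → f i ≤ g i) → ∀ i → f i < g i → sum f < sum g
sum-mono-< f≤g zero    f<g = +-mono-<-≤ f<g (sum-mono-≤ (f≤g ∘ suc))
sum-mono-< f≤g (suc i) f<g = +-mono-≤-< (f≤g zero) (sum-mono-< (f≤g ∘ suc) i f<g)

sum-const : ∀ n c → ∑[ i < n ] c ≡ n * c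
sum-const zero    c = refl
sum-const (suc n) c = cong (c +_) (sum-const n c)

𝟙 : Bool → ℕ
𝟙 b = if b then 1 else 0

𝟙≤1 : ∀ b → 𝟙 b ≤ 1
𝟙≤1 true  = ≤-refl
𝟙≤1 false = z≤n

𝟙-∧ : ∀ a b → 𝟙 (a ∧ b) ≡ 𝟙 a * 𝟙 b
𝟙-∧ true  b = sym (+-identityʳ (𝟙 b))
𝟙-∧ false b = refl

count-tabulate : ∀ {A : Set} {P : A → Set} (P? : Unary.Decidable P) {n} (f : Fin n → A) →
                 count P? (tabulate f) ≡ ∑[ i < n ] 𝟙 (does (P? (f i)))
count-tabulate P? {zero}  f = refl
count-tabulate P? {suc n} f with does (P? (f zero))
... | true  = cong suc (count-tabulate P? (f ∘ suc))
... | false = count-tabulate P? (f ∘ suc)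

module _ {n : ℕ} (G : Graph n) where
  open Graph G

  adj : Fin n → Fin n → ℕ
  adj i j = 𝟙 (does (i ~? j))

  degree : Fin n → ℕ
  degree i = ∑[ j < n ] adj i j

  adj-sym : ∀ i j → adj i j ≡ adj j i
  adj-sym i j = cong 𝟙 (does-⇔ (mk⇔ ~-sym ~-sym) (i ~? j) (j ~? i))

  adj-irrefl : ∀ i → adj i i ≡ 0
  adj-irrefl i = cong 𝟙 (dec-false (i ~? i) (~-irrefl refl))

-- Forests

module _ {n : ℕ} (G : Graph n) where
  open Graph G

  module _ (w : ℕ → Fin n) (w-step : ∀ t → w t ~ w (suc t))
           (w-turn : ∀ t → w (suc (suc t)) ≢ w t) where

    -- Descent on `j` reaches an index before which no vertex repeats. The closed stretch from `w i`
    -- to `w (j − 1)` is then a cycle: irreflexivity rules out closed walks of length one, and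
    -- `w-turn` those of length two.
    repeat⇒cycle : ∀ j → Acc _<_ j → ∀ i → i < j → w i ≡ w j → Cycle G
    repeat⇒cycle j (acc rec) i i<j wi≡wj
      with any? {n = j} (λ b → any? {n = toℕ b} (λ a → w (toℕ a) Fin.≟ w (toℕ b)))
    ... | yes (b , a , e) = repeat⇒cycle (toℕ b) (rec (toℕ<n b)) (toℕ a) (toℕ<n a) e
    ... | no ¬rep with m≤n⇒∃[o]m+o≡n i<j
    ...   | m , refl = record
      { m           = m
      ; m≥2         = length≥2 m wi≡wj
      ; c           = λ a → w (i + toℕ a)
      ; c-injective = injective
      ; c-step      = λ a → subst₂ (λ p q → w p ~ w q)
                        (cong (i +_) (sym (toℕ-inject₁ a))) (sym (+-suc i (toℕ a)))
                        (w-step (i + toℕ a))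
      ; c-close     = subst₂ _~_ (cong (λ p → w (i + p)) (sym (toℕ-fromℕ m)))
                        (trans (sym wi≡wj) (cong w (sym (+-identityʳ i))))
                        (w-step (i + m))
      }
      where
      length≥2 : ∀ l → w i ≡ w (suc i + l) → 2 ≤ l
      length≥2 0 e = contradiction
        (subst (w i ~_) (trans (cong w (cong suc (sym (+-identityʳ i)))) (sym e)) (w-step i))
        (~-irrefl refl)
      length≥2 1 e = contradiction
        (trans (cong w (cong suc (sym (+-comm i 1)))) (sym e)) (w-turn i)
      length≥2 (suc (suc l)) _ = s≤s (s≤s z≤n)

      distinct : ∀ a b → a < b → b < suc i + m → w a ≢ w b
      -- The inner index ranges below `toℕ (fromℕ< b<j)`, not below `b` itself, so its witness is
      -- transported along `toℕ-fromℕ<`.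
      distinct a b a<b b<j e = ¬rep (fromℕ< b<j , subst (λ p → ∃ λ (x : Fin p) → w (toℕ x) ≡ w p)
        (sym (toℕ-fromℕ< b<j)) (fromℕ< a<b , trans (cong w (toℕ-fromℕ< a<b)) e))

      bound : ∀ (a : Fin (suc m)) → i + toℕ a < suc i + m
      bound a = subst (i + toℕ a <_) (+-suc i m) (+-monoʳ-< i (toℕ<n a))

      injective : ∀ {a b : Fin (suc m)} → w (i + toℕ a) ≡ w (i + toℕ b) → a ≡ b
      injective {a} {b} e with <-cmp (toℕ a) (toℕ b)
      ... | tri< a<b _ _ = contradiction e (distinct _ _ (+-monoʳ-< i a<b) (bound b))
      ... | tri≈ _ a≡b _ = toℕ-injective a≡b
      ... | tri> _ _ b<a = contradiction (sym e) (distinct _ _ (+-monoʳ-< i b<a) (bound a))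

    nonbacktracking⇒cycle : Cycle G
    nonbacktracking⇒cycle with pigeonhole (n<1+n n) (w ∘ toℕ)
    ... | i , j , i<j , e = repeat⇒cycle (toℕ j) (<-wellFounded _) (toℕ i) i<j e

module _ {n : ℕ} (G : Graph (suc n)) where
  open Graph G

  -- If no neighbour differs from `p`, only the term of `p` survives in the degree sum, and that
  -- term is at most 1.
  otherNeighbour : ∀ u p → 2 ≤ degree G u → ∃ λ v → u ~ v × v ≢ p
  otherNeighbour u p 2≤d with any? (λ v → (u ~? v) ×-dec ¬? (v Fin.≟ p))
  ... | yes found = found
  ... | no ¬found = contradiction 2≤d (<⇒≱ (s≤s d≤1))
    where
    open ≤-Reasoning
    d≤1 : degree G u ≤ 1
    d≤1 = begin
      degree G u                                    ≡⟨ sum-remove {i = p} (adj G u) ⟩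
      adj G u p + ∑[ j < n ] adj G u (punchIn p j)  ≡⟨ cong (adj G u p +_) (sum-cong-≗ λ j →
                                                         cong 𝟙 (dec-false (u ~? punchIn p j) λ u~j →
                                                           ¬found (_ , u~j , punchInᵢ≢i p j))) ⟩
      adj G u p + ∑[ j < n ] 0                      ≡⟨ cong (adj G u p +_) (sum-replicate-zero n) ⟩
      adj G u p + 0                                 ≡⟨ +-identityʳ _ ⟩
      adj G u p                                     ≤⟨ 𝟙≤1 _ ⟩
      1                                             ∎

  -- With all degrees at least 2, a walk can be prolonged forever without turning back.
  minDegree≥2⇒cycle : (∀ u → 2 ≤ degree G u) → Cycle G
  minDegree≥2⇒cycle deg≥2 = nonbacktracking⇒cycle G
    (proj₁ ∘ arc) (λ t → proj₂ (proj₂ (arc t))) (λ t → proj₂ (proj₂ (extend (arc t))))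
    where
    -- The walk remembers its current edge, since the next vertex must avoid the previous one. Its
    -- vertex sequence consists of the sources of the arcs.
    Arc : Set
    Arc = ∃₂ _~_

    extend : ((u , v , _) : Arc) → ∃ λ w → v ~ w × w ≢ u
    extend (u , v , _) = otherNeighbour v u (deg≥2 v)

    advance : Arc → Arc
    advance a@(_ , v , _) = v , proj₁ (extend a) , proj₁ (proj₂ (extend a))

    first : Arc
    -- The excluded vertex is a placeholder: any neighbour of `zero` can start the walk.
    first with otherNeighbour zero zero (deg≥2 zero)
    ... | v , 0~v , _ = zero , v , 0~v

    arc : ℕ → Arc
    arc = fold first advance

  acyclic⇒leaf : ¬ Cycle G → ∃ λ v → degree G v ≤ 1
  acyclic⇒leaf acyclic with any? (λ v → degree G v ≤? 1)
  ... | yes leaf  = leaf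
  ... | no  ¬leaf = contradiction (minDegree≥2⇒cycle λ u → ≰⇒> λ d≤1 → ¬leaf (u , d≤1)) acyclic

  delete : Fin (suc n) → Graph n
  delete v = record
    { _~_      = λ i j → punchIn v i ~ punchIn v j
    ; ~-sym    = ~-sym
    ; ~-irrefl = λ i≡j → ~-irrefl (cong (punchIn v) i≡j)
    ; _~?_     = λ i j → punchIn v i ~? punchIn v j
    }

  cycle-delete : ∀ v → Cycle (delete v) → Cycle G
  cycle-delete v C = record
    { m           = m
    ; m≥2         = m≥2
    ; c           = punchIn v ∘ c
    ; c-injective = c-injective ∘ punchIn-injective v _ _
    ; c-step      = c-step
    ; c-close     = c-close
    }
    where open Cycle C

  -- In the adjacency matrix, deleting `v` removes a row and a column. By symmetry each of them sums
  -- to `degree G v`.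
  degreeSum-delete : ∀ v → sum (degree G) ≡ degree G v + degree G v + sum (degree (delete v))
  degreeSum-delete v = begin
    sum (degree G)
      ≡⟨ sum-remove {i = v} (degree G) ⟩
    d + ∑[ i < n ] degree G (↑ i)
      ≡⟨ cong (d +_) (sum-cong-≗ λ i → sum-remove {i = v} (adj G (↑ i))) ⟩
    d + ∑[ i < n ] (adj G (↑ i) v + degree (delete v) i)
      ≡⟨ cong (d +_) (∑-distrib-+ (λ i → adj G (↑ i) v) (degree (delete v))) ⟩
    d + (∑[ i < n ] adj G (↑ i) v + rest)
      ≡⟨ cong (λ e → d + (e + rest)) (sum-cong-≗ λ i → adj-sym G (↑ i) v) ⟩
    d + (∑[ i < n ] adj G v (↑ i) + rest)
      -- Inserting the zero diagonal entry completes the punctured row of `v` to its full degree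
      -- sum.
      ≡⟨ cong (λ z → d + (z + ∑[ i < n ] adj G v (↑ i) + rest)) (sym (adj-irrefl G v)) ⟩
    d + (adj G v v + ∑[ i < n ] adj G v (↑ i) + rest)
      ≡⟨ cong (λ e → d + (e + rest)) (sym (sum-remove {i = v} (adj G v))) ⟩
    d + (d + rest)
      ≡⟨ +-assoc d d rest ⟨
    d + d + rest ∎
    where
    open ≡-Reasoning
    ↑    = punchIn v
    d    = degree G v
    rest = sum (degree (delete v))

-- Deleting a vertex of degree at most 1 keeps the graph acyclic and lowers the degree sum by at
-- most 2.
acyclic⇒degreeSum≤ : ∀ n (G : Graph (suc n)) → ¬ Cycle G → sum (degree G) ≤ n * 2
acyclic⇒degreeSum≤ zero    G acyclic =
  ≤-reflexive (trans (+-identityʳ _) (trans (+-identityʳ _) (adj-irrefl G zero)))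
acyclic⇒degreeSum≤ (suc n) G acyclic with acyclic⇒leaf G acyclic
... | v , d≤1 = begin
  sum (degree G)                                      ≡⟨ degreeSum-delete G v ⟩
  degree G v + degree G v + sum (degree (delete G v)) ≤⟨ +-mono-≤ (+-mono-≤ d≤1 d≤1)
                                                           (acyclic⇒degreeSum≤ n (delete G v)
                                                             (acyclic ∘ cycle-delete G v)) ⟩
  suc n * 2                                           ∎
  where open ≤-Reasoning

-- The potential

disagree : Sign → Sign → ℕ
disagree s t = 𝟙 (not (does (s Sign.≟ t)))

disagree-sym : ∀ s t → disagree s t ≡ disagree t s
disagree-sym Sign.- Sign.- = refl
disagree-sym Sign.- Sign.+ = refl
disagree-sym Sign.+ Sign.- = refl
disagree-sym Sign.+ Sign.+ = refl

disagree-opposite : ∀ s t → disagree s t + disagree s (opposite t) ≡ 1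
disagree-opposite Sign.- Sign.- = refl
disagree-opposite Sign.- Sign.+ = refl
disagree-opposite Sign.+ Sign.- = refl
disagree-opposite Sign.+ Sign.+ = refl

≡⊎≡opposite : ∀ s t → s ≡ t ⊎ s ≡ opposite t
≡⊎≡opposite Sign.- Sign.- = inj₁ refl
≡⊎≡opposite Sign.- Sign.+ = inj₂ refl
≡⊎≡opposite Sign.+ Sign.- = inj₂ refl
≡⊎≡opposite Sign.+ Sign.+ = inj₁ refl

-- The threshold is k = suc κ, so that 2k − 1 is κ + suc κ.
module _ {n : ℕ} (G : Graph n) (κ : ℕ) where
  open Graph G

  opposition : Config n → Fin n → Sign → ℕ
  opposition y i s = ∑[ j < n ] (adj G i j * disagree (lookup y j) s)

  -- With `o` opposed neighbours and `o′` others, keeping the state costs `o + deg i`, that is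
  -- `2o + o′`, and flipping costs `o′ + 2k − 1`. So `2o` is compared with `2k − 1`; as the latter
  -- is odd, ties cannot occur, and flipping wins exactly when `o ≥ k`.
  inertia : Fin n → Sign → Sign → ℕ
  inertia i s t = if does (s Sign.≟ t) then degree G i else κ + suc κ

  cost : Config n → Fin n → Sign → ℕ
  cost y i s = opposition y i s + inertia i s (lookup y i)

  potential : Config n → Config n → ℕ
  potential x y = ∑[ i < n ] cost y i (lookup x i)

  op≡opposition : ∀ y i → op G y i ≡ opposition y i (lookup y i)
  op≡opposition y i = trans
    (count-tabulate (λ j → (i ~? j) ×-dec ¬? (lookup y j Sign.≟ lookup y i)) id)
    (sum-cong-≗ λ j → 𝟙-∧ (does (i ~? j)) _)

  -- The state of each neighbour disagrees with exactly one of `s` and `opposite s`.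
  opposition-opposite : ∀ y i s → opposition y i s + opposition y i (opposite s) ≡ degree G i
  opposition-opposite y i s = trans
    (sym (∑-distrib-+ (λ j → adj G i j * disagree (lookup y j) s) _))
    (sum-cong-≗ λ j → trans (sym (*-distribˡ-+ (adj G i j) _ _))
      (trans (cong (adj G i j *_) (disagree-opposite (lookup y j) s)) (*-identityʳ _)))

  inertia-sym : ∀ i s t → inertia i s t ≡ inertia i t s
  inertia-sym i s t = cong (if_then degree G i else κ + suc κ)
    (does-⇔ (mk⇔ sym sym) (s Sign.≟ t) (t Sign.≟ s))

  inertia-same : ∀ i s → inertia i s s ≡ degree G i
  inertia-same i Sign.- = refl
  inertia-same i Sign.+ = refl

  inertia-opposite : ∀ i s → inertia i (opposite s) s ≡ κ + suc κ
  inertia-opposite i Sign.- = refl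
  inertia-opposite i Sign.+ = refl

  -- The opposition part is a double sum over ordered pairs of vertices. Exchanging the summations
  -- swaps `x` and `y`, because `adj` and `disagree` are symmetric; the inertia part is symmetric
  -- term by term.
  potential-sym : ∀ x y → potential x y ≡ potential y x
  potential-sym x y = begin
    potential x y
      ≡⟨ ∑-distrib-+ (λ i → opposition y i (lookup x i)) _ ⟩
    ∑[ i < n ] ∑[ j < n ] (adj G i j * disagree (lookup y j) (lookup x i)) + inertias x y
      ≡⟨ cong₂ _+_ (∑-comm (λ i j → adj G i j * disagree (lookup y j) (lookup x i)))
           (sum-cong-≗ λ i → inertia-sym i (lookup x i) (lookup y i)) ⟩
    ∑[ j < n ] ∑[ i < n ] (adj G i j * disagree (lookup y j) (lookup x i)) + inertias y x
      ≡⟨ cong (_+ inertias y x) (sum-cong-≗ λ j → sum-cong-≗ λ i →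
           cong₂ _*_ (adj-sym G i j) (disagree-sym (lookup y j) (lookup x i))) ⟩
    ∑[ j < n ] ∑[ i < n ] (adj G j i * disagree (lookup x i) (lookup y j)) + inertias y x
      ≡⟨ ∑-distrib-+ (λ i → opposition x i (lookup y i)) _ ⟨
    potential y x ∎
    where
    open ≡-Reasoning
    inertias : Config n → Config n → ℕ
    inertias x y = ∑[ i < n ] inertia i (lookup x i) (lookup y i)

  module _ (y : Config n) (i : Fin n) where
    private
      t next : Sign
      t    = lookup y i
      next = lookup (step G (suc κ) y) i

      d o o′ : ℕ
      d  = degree G i
      o  = opposition y i t
      o′ = opposition y i (opposite t)

      o+o′≡d : o + o′ ≡ d
      o+o′≡d = opposition-opposite y i t

      cost-same : cost y i t ≡ o + d
      cost-same = cong (o +_) (inertia-same i t)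

      cost-opposite : cost y i (opposite t) ≡ o′ + (κ + suc κ)
      cost-opposite = cong (o′ +_) (inertia-opposite i t)

      choose : Bool → Sign
      choose b = if b then opposite t else t

      next≡ : next ≡ choose (does (suc κ ≤? op G y i))
      next≡ = lookup∘tabulate _ i

      update : (κ < o × next ≡ opposite t) ⊎ (o ≤ κ × next ≡ t)
      update with suc κ ≤? op G y i
      ... | yes k≤op = inj₁ ( subst (κ <_) (op≡opposition y i) k≤op
                            , trans next≡ (cong choose (dec-true (suc κ ≤? op G y i) k≤op)))
      ... | no  k≰op = inj₂ ( subst (_≤ κ) (op≡opposition y i) (≮⇒≥ k≰op)
                            , trans next≡ (cong choose (dec-false (suc κ ≤? op G y i) k≰op)))

      opposite<same : κ < o → cost y i (opposite t) < cost y i t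
      opposite<same κ<o = begin-strict
        cost y i (opposite t) ≡⟨ cost-opposite ⟩
        -- `κ < o` serves twice: as a strict bound on `κ`, and unfolded as `suc κ ≤ o`.
        o′ + (κ + suc κ)      <⟨ +-monoʳ-< o′ (+-mono-<-≤ κ<o κ<o) ⟩
        o′ + (o + o)          ≡⟨ +-comm o′ (o + o) ⟩
        o + o + o′            ≡⟨ +-assoc o o o′ ⟩
        o + (o + o′)          ≡⟨ cong (o +_) o+o′≡d ⟩
        o + d                 ≡⟨ cost-same ⟨
        cost y i t            ∎
        where open ≤-Reasoning

      same<opposite : o ≤ κ → cost y i t < cost y i (opposite t)
      same<opposite o≤κ = begin-strict
        cost y i t            ≡⟨ cost-same ⟩
        o + d                 ≡⟨ cong (o +_) o+o′≡d ⟨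
        o + (o + o′)          ≡⟨ +-assoc o o o′ ⟨
        o + o + o′            ≡⟨ +-comm (o + o) o′ ⟩
        o′ + (o + o)          <⟨ +-monoʳ-< o′ (+-mono-≤-< o≤κ (s≤s o≤κ)) ⟩
        o′ + (κ + suc κ)      ≡⟨ cost-opposite ⟨
        cost y i (opposite t) ∎
        where open ≤-Reasoning

    -- Summed over `i`, this bounds the initial potential. A flip has `suc κ ≤ o`, which replaces
    -- one summand of the penalty by `o` and completes `o′` to the degree; without a flip, `o ≤ κ`
    -- suffices.
    cost-next-≤ : cost y i next ≤ κ + d
    cost-next-≤ with update
    ... | inj₁ (κ<o , e) = begin
      cost y i next         ≡⟨ cong (cost y i) e ⟩
      cost y i (opposite t) ≡⟨ cost-opposite ⟩
      o′ + (κ + suc κ)      ≤⟨ +-monoʳ-≤ o′ (+-monoʳ-≤ κ κ<o) ⟩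
      o′ + (κ + o)          ≡⟨ +-comm o′ (κ + o) ⟩
      κ + o + o′            ≡⟨ +-assoc κ o o′ ⟩
      κ + (o + o′)          ≡⟨ cong (κ +_) o+o′≡d ⟩
      κ + d                 ∎
      where open ≤-Reasoning
    ... | inj₂ (o≤κ , e) = begin
      cost y i next ≡⟨ cong (cost y i) e ⟩
      cost y i t    ≡⟨ cost-same ⟩
      o + d         ≤⟨ +-monoˡ-≤ d o≤κ ⟩
      κ + d         ∎
      where open ≤-Reasoning

    next-minimises-< : ∀ s → s ≢ next → cost y i next < cost y i s
    next-minimises-< s s≢next with update | ≡⊎≡opposite s t
    ... | inj₁ (κ<o , e) | inj₁ refl = subst (λ u → cost y i u < cost y i s) (sym e) (opposite<same κ<o)
    ... | inj₁ (κ<o , e) | inj₂ s≡   = contradiction (trans s≡ (sym e)) s≢next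
    ... | inj₂ (o≤κ , e) | inj₁ s≡   = contradiction (trans s≡ (sym e)) s≢next
    ... | inj₂ (o≤κ , e) | inj₂ refl = subst (λ u → cost y i u < cost y i s) (sym e) (same<opposite o≤κ)

    next-minimises-≤ : ∀ s → cost y i next ≤ cost y i s
    next-minimises-≤ s with s Sign.≟ next
    ... | yes refl   = ≤-refl
    ... | no  s≢next = <⇒≤ (next-minimises-< s s≢next)

  -- The summands depend on separate coordinates of `x`, and the successor of `y` minimises each of
  -- them. A coordinate where `x` differs from it makes one inequality strict; finite search finds
  -- such a coordinate or shows the configurations equal.
  potential-step-< : ∀ x y → x ≢ step G (suc κ) y → potential (step G (suc κ) y) y < potential x y
  potential-step-< x y x≢y′ with any? (λ i → ¬? (lookup x i Sign.≟ lookup (step G (suc κ) y) i))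
  ... | yes (i , xi≢) = sum-mono-< (λ j → next-minimises-≤ y j (lookup x j)) i
                          (next-minimises-< y i (lookup x i) xi≢)
  ... | no  agree     = contradiction x≡y′ x≢y′
    where
    lookup≡ : ∀ i → lookup x i ≡ lookup (step G (suc κ) y) i
    lookup≡ i with lookup x i Sign.≟ lookup (step G (suc κ) y) i
    ... | yes e  = e
    ... | no  ¬e = contradiction (i , ¬e) agree

    x≡y′ : x ≡ step G (suc κ) y
    x≡y′ = trans (sym (tabulate∘lookup x)) (trans (tabulate-cong lookup≡) (tabulate∘lookup _))

  potential-step-≤ : ∀ y → potential (step G (suc κ) y) y ≤ n * κ + sum (degree G)
  potential-step-≤ y = begin
    potential (step G (suc κ) y) y    ≤⟨ sum-mono-≤ (cost-next-≤ y) ⟩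
    ∑[ i < n ] (κ + degree G i)       ≡⟨ ∑-distrib-+ (λ _ → κ) (degree G) ⟩
    ∑[ i < n ] κ + sum (degree G)     ≡⟨ cong (_+ sum (degree G)) (sum-const n κ) ⟩
    n * κ + sum (degree G)            ∎
    where open ≤-Reasoning

-- Bounding the transient length

decreasing⇒length≤ : ∀ (f : ℕ → ℕ) l → (∀ t → t < l → f (suc t) < f t) → l ≤ f 0
decreasing⇒length≤ f zero    decreasing = z≤n
decreasing⇒length≤ f (suc l) decreasing =
  ≤-<-trans (decreasing⇒length≤ (f ∘ suc) l λ t t<l → decreasing (suc t) (s<s t<l))
            (decreasing 0 z<s)

transientLength≤ : ∀ {n} (G : Graph n) κ (x₀ : Config n) →
                   transientLength G (suc κ) x₀ ≤ n * κ + sum (degree G)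
transientLength≤ G κ x₀ = ≤-trans
  (decreasing⇒length≤ (λ t → potential G κ (x (suc t)) (x t)) _ decreasing)
  (potential-step-≤ G κ x₀)
  where
  x = process G (suc κ) x₀

  decreasing : ∀ t → t < transientLength G (suc κ) x₀ →
               potential G κ (x (2 + t)) (x (suc t)) < potential G κ (x (suc t)) (x t)
  decreasing t t<τ = subst (potential G κ (x (2 + t)) (x (suc t)) <_)
    (potential-sym G κ (x t) (x (suc t)))
    -- No configuration from before the end of the transient recurs later, in particular not two
    -- steps later.
    (potential-step-< G κ (x t) (x (suc t)) λ e → minimal t 2 (s≤s z≤n) (inj₁ t<τ)
      (trans (cong x (+-comm t 2)) (sym e)))
    where open IsPeriodTransient (isPeriodTransient G (suc κ) x₀)

corollary8 : (n : ℕ) (G : Graph n) → IsTree G →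
    (k : ℕ) → 1 ≤ k →
    (x₀ : Config n) →
    transientLength G k x₀ ≤ n * (k + 1) ∸ 1
corollary8 zero    G tree k       1≤k x₀ with () ← IsTree.nonempty tree
corollary8 (suc m) G tree (suc κ) 1≤k x₀ = begin
  transientLength G (suc κ) x₀   ≤⟨ transientLength≤ G κ x₀ ⟩
  suc m * κ + sum (degree G)     ≤⟨ +-monoʳ-≤ (suc m * κ) (acyclic⇒degreeSum≤ m G (IsTree.acyclic tree)) ⟩
  -- The estimate reached is `n (k + 1) − 2`, one below the target. The subtraction in the target
  -- computes away because the product is a successor.
  suc m * κ + m * 2              ≤⟨ n≤1+n _ ⟩
  suc (suc m * κ + m * 2)        ≡⟨ rearrange m κ ⟩
  κ + 1 + m * (suc κ + 1)        ∎
  where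
  open ≤-Reasoning
  rearrange : ∀ m κ → suc (suc m * κ + m * 2) ≡ κ + 1 + m * (suc κ + 1)
  rearrange = solve-∀
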